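{- Let $\mathbf P=(P,x_L,x_R)$ be an oriented poset with vertex weights $w$. The weight matrices corresponding to the source loops $\rhd(\mathbf P\!\searrow)$ and $\rhd(\mathbf P\!\nearrow)$ are given by $$\mathcal M_w\big((\rhd(\mathbf P\!\searrow))\!\searrow\big)=\mathrm{loop}_\searrow\big(\mathcal M_w(\mathbf P\!\searrow)\big),\qquad \mathcal M_w\big((\rhd(\mathbf P\!\nearrow))\!\searrow\big)=\mathrm{loop}_\nearrow\big(\mathcal M_w(\mathbf P\!\nearrow)\big),$$ where $$\mathrm{loop}_\searrow\begin{bmatrix} a & b \\ c & d \end{bmatrix}=\begin{bmatrix} a+d & b-d \\ a+b & 0 \end{bmatrix},\qquad \mathrm{loop}_\nearrow\begin{bmatrix} a & b \\ c & d \end{bmatrix}=\begin{bmatrix} a+d & -a \\ d & 0 \end{bmatrix}.$$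
   Context: An oriented poset $\mathbf P=(P,x_L,x_R)$ is a finite poset $P$ with two specified vertices $x_L$ (left, or target vertex) and $x_R$ (right, or source vertex), possibly equal. Each vertex $i$ of $P$ carries a weight variable $w_i$. An order ideal is a down-closed subset, $J(P)$ is the set of order ideals, and $\mathcal W(P;w)=\sum_{I\in J(P)}\prod_{i\in I}w_i$ is the weight polynomial. A restriction such as $\mathcal W(\mathbf P;w)|_{x_R\in I,\,x_L\notin I}$ means that the sum is only over ideals $I$ satisfying the stated conditions. Down-pointing weight matrix: $$\mathcal M_w(\mathbf P\!\searrow)=\begin{bmatrix}\mathcal W(\mathbf P;w)&-\mathcal W(\mathbf P;w)|_{x_R\in I} \\ \mathcal W(\mathbf P;w)|_{x_L\notin I}&-\mathcal W(\mathbf P;w)|_{x_R\in I,\,x_L\notin I}\end{bmatrix}.$$ Up-pointing weight matrix: $$\mathcal M_w(\mathbf P\!\nearrow)=\begin{bmatrix}\mathcal W(\mathbf P;w)|_{x_R\in I}&\mathcal W(\mathbf P;w)|_{x_R\notin I} \\ \mathcal W(\mathbf P;w)|_{x_R\in I,\,x_L\notin I}&\mathcal W(\mathbf P;w)|_{x_R\notin I,\,x_L\notin I}\end{bmatrix}.$$ $\circlearrowright(\mathbf P\!\searrow)$ denotes the poset obtained from $P$ by adding the relation $x_L\preceq x_R$, and $\circlearrowright(\mathbf P\!\nearrow)$ the poset obtained by adding the relation $x_L\succeq x_R$ (in both cases taking the transitive closure, which is understood to be again a partial order). The source loops are the oriented posets $\rhd(\mathbf P\!\searrow)=(\circlearrowright(\mathbf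 P\!\searrow),x_R,x_R)$ and $\rhd(\mathbf P\!\nearrow)=(\circlearrowright(\mathbf P\!\nearrow),x_R,x_R)$, whose target and source vertices are both $x_R$. -}

module Defs where

open import Algebra.Bundles using (CommutativeRing)
open import Data.Fin.Base using (Fin)
open import Data.Fin.Properties using (all?; _≟_)
open import Data.Fin.Subset using (Subset; inside; outside; _∈_; _∉_)
open import Data.Fin.Subset.Properties using (_∈?_)
open import Data.List.Base using (List; []; _∷_; _++_; map; filter; foldr; allFin)
open import Data.Nat.Base using (ℕ; zero; suc)
open import Data.Product.Base using (_×_; _,_)
open import Data.Sum.Base using (_⊎_; inj₁; inj₂)
open import Data.Vec.Base using (Vec; []; _∷_)
import Data.Vec.Relation.Binary.Pointwise.Inductive as Vec
open import Level using (Level; 0ℓ; _⊔_)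
open import Relation.Binary.Construct.Closure.Transitive using (TransClosure; [_]; _∷_)
open import Relation.Binary.Core using (Rel)
open import Relation.Binary.Definitions using () renaming (Decidable to Decidable₂)
open import Relation.Binary.PropositionalEquality.Core using (_≡_; refl)
open import Relation.Binary.Structures using (IsPartialOrder; IsDecPartialOrder)
open import Relation.Nullary.Decidable using (map′; _×-dec_; _⊎-dec_; _→-dec_; ¬?)
open import Relation.Unary using (Pred; Decidable)

private
  variable
    n : ℕ

------------------------------------------------------------------------
-- Finite posets and order ideals

-- The vertices are labelled by Fin n.  The order is decidable, as is
-- automatic classically, so that the order ideals can be enumerated.
record FinPoset (n : ℕ) : Set₁ where
  infix 4 _⪯_
  field
    _⪯_               : Rel (Fin n) 0ℓ
    isDecPartialOrder : IsDecPartialOrder _≡_ _⪯_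

  open IsDecPartialOrder isDecPartialOrder public
    using (isPartialOrder) renaming (refl to ⪯-refl; trans to ⪯-trans; _≤?_ to _⪯?_)

  IsOrderIdeal : Pred (Subset n) 0ℓ
  IsOrderIdeal I = ∀ x y → x ⪯ y → y ∈ I → x ∈ I

  isOrderIdeal? : Decidable IsOrderIdeal
  isOrderIdeal? I =
    all? λ x → all? λ y → (x ⪯? y) →-dec ((y ∈? I) →-dec (x ∈? I))

-- Every subset of Fin n, exactly once.
subsets : ∀ n → List (Subset n)
subsets zero    = [] ∷ []
subsets (suc n) = map (outside ∷_) (subsets n) ++ map (inside ∷_) (subsets n)

J : FinPoset n → List (Subset n)
J {n} P = filter (FinPoset.isOrderIdeal? P) (subsets n)

------------------------------------------------------------------------
-- Adding a relation to a poset

module _ (P : FinPoset n) (a b : Fin n) where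
  open FinPoset P

  AddedRelation : Rel (Fin n) 0ℓ
  AddedRelation = TransClosure (λ x y → x ⪯ y ⊎ (x ≡ a × y ≡ b))

  toAdded : ∀ {x y} → x ⪯ y ⊎ (x ⪯ a × b ⪯ y) → AddedRelation x y
  toAdded (inj₁ x⪯y)         = [ inj₁ x⪯y ]
  toAdded (inj₂ (x⪯a , b⪯y)) = inj₁ x⪯a ∷ inj₂ (refl , refl) ∷ [ inj₁ b⪯y ]

  fromAdded : ∀ {x y} → AddedRelation x y → x ⪯ y ⊎ (x ⪯ a × b ⪯ y)
  fromAdded [ inj₁ x⪯y ] = inj₁ x⪯y
  fromAdded [ inj₂ (refl , refl) ] = inj₂ (⪯-refl , ⪯-refl)
  fromAdded (inj₁ x⪯z ∷ zs) with fromAdded zs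
  ... | inj₁ z⪯y = inj₁ (⪯-trans x⪯z z⪯y)
  ... | inj₂ (z⪯a , b⪯y) = inj₂ (⪯-trans x⪯z z⪯a , b⪯y)
  fromAdded (inj₂ (refl , refl) ∷ zs) with fromAdded zs
  ... | inj₁ b⪯y = inj₂ (⪯-refl , b⪯y)
  ... | inj₂ (_ , b⪯y) = inj₂ (⪯-refl , b⪯y)

  addedRelation? : Decidable₂ AddedRelation
  addedRelation? x y =
    map′ toAdded fromAdded ((x ⪯? y) ⊎-dec ((x ⪯? a) ×-dec (b ⪯? y)))

  addRelation : IsPartialOrder _≡_ AddedRelation → FinPoset n
  addRelation po = record
    { _⪯_               = AddedRelation
    ; isDecPartialOrder = record
      { isPartialOrder = po
      ; _≟_            = _≟_
      ; _≤?_           = addedRelation?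
      }
    }

------------------------------------------------------------------------
-- Oriented posets and loops

record OrientedPoset (n : ℕ) : Set₁ where
  constructor ⟨_,_,_⟩
  field
    poset : FinPoset n
    x-L   : Fin n
    x-R   : Fin n

  R∈? : Decidable (x-R ∈_)
  R∈? I = x-R ∈? I

  R∉? : Decidable (x-R ∉_)
  R∉? I = ¬? (x-R ∈? I)

  L∉? : Decidable (x-L ∉_)
  L∉? I = ¬? (x-L ∈? I)

  R∈,L∉? : Decidable (λ I → x-R ∈ I × x-L ∉ I)
  R∈,L∉? I = R∈? I ×-dec L∉? I

  R∉,L∉? : Decidable (λ I → x-R ∉ I × x-L ∉ I)
  R∉,L∉? I = R∉? I ×-dec L∉? I

module _ (𝐏 : OrientedPoset n) where
  open OrientedPoset 𝐏

  -- The closure need not be antisymmetric: it fails to be when the two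
  -- vertices are distinct and already comparable the other way round.
  Admissible↘ : Set
  Admissible↘ = IsPartialOrder _≡_ (AddedRelation poset x-L x-R)

  Admissible↗ : Set
  Admissible↗ = IsPartialOrder _≡_ (AddedRelation poset x-R x-L)

  ↻↘ : Admissible↘ → FinPoset n
  ↻↘ = addRelation poset x-L x-R

  ↻↗ : Admissible↗ → FinPoset n
  ↻↗ = addRelation poset x-R x-L

  ▷↘ : Admissible↘ → OrientedPoset n
  ▷↘ po = ⟨ ↻↘ po , x-R , x-R ⟩

  ▷↗ : Admissible↗ → OrientedPoset n
  ▷↗ po = ⟨ ↻↗ po , x-R , x-R ⟩

------------------------------------------------------------------------
-- Weight polynomials and weight matrices

-- The weights are arbitrary elements of an arbitrary commutative ring R.
-- Taking R to be a polynomial ring and the weights its variables gives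
-- the weight polynomials themselves.
module Weights {c ℓ : Level} (R : CommutativeRing c ℓ) where
  open CommutativeRing R using (Carrier; _≈_; _+_; _*_; -_; _-_; 0#; 1#)

  ∑ : {a : Level} {A : Set a} → List A → (A → Carrier) → Carrier
  ∑ xs f = foldr _+_ 0# (map f xs)

  ∏ : {a : Level} {A : Set a} → List A → (A → Carrier) → Carrier
  ∏ xs f = foldr _*_ 1# (map f xs)

  weight : (Fin n → Carrier) → Subset n → Carrier
  weight {n} w I = ∏ (filter (_∈? I) (allFin n)) w

  𝒲 : FinPoset n → (Fin n → Carrier) → Carrier
  𝒲 P w = ∑ (J P) (weight w)

  -- The sum over those order ideals that satisfy Q.
  𝒲∣ : FinPoset n → (Fin n → Carrier) →
        {Q : Pred (Subset n) 0ℓ} → Decidable Q → Carrier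
  𝒲∣ P w Q? = ∑ (filter Q? (J P)) (weight w)

  Matrix₂ : Set c
  Matrix₂ = Vec (Vec Carrier 2) 2

  infix 4 _≈ᴹ_
  _≈ᴹ_ : Rel Matrix₂ (c ⊔ ℓ)
  _≈ᴹ_ = Vec.Pointwise (Vec.Pointwise _≈_)

  module _ (𝐏 : OrientedPoset n) (w : Fin n → Carrier) where
    open OrientedPoset 𝐏 renaming (poset to P)

    ℳ↘ : Matrix₂
    ℳ↘ = (𝒲 P w       ∷ - 𝒲∣ P w R∈?    ∷ [])
       ∷ (𝒲∣ P w L∉?  ∷ - 𝒲∣ P w R∈,L∉? ∷ [])
       ∷ []

    ℳ↗ : Matrix₂
    ℳ↗ = (𝒲∣ P w R∈?    ∷ 𝒲∣ P w R∉?    ∷ [])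
       ∷ (𝒲∣ P w R∈,L∉? ∷ 𝒲∣ P w R∉,L∉? ∷ [])
       ∷ []

  loop↘ : Matrix₂ → Matrix₂
  loop↘ ((a ∷ b ∷ []) ∷
         (c ∷ d ∷ []) ∷ []) = (a + d ∷ b - d ∷ [])
                            ∷ (a + b ∷ 0#    ∷ [])
                            ∷ []

  loop↗ : Matrix₂ → Matrix₂
  loop↗ ((a ∷ b ∷ []) ∷
         (c ∷ d ∷ []) ∷ []) = (a + d ∷ - a ∷ [])
                            ∷ (d     ∷ 0#  ∷ [])
                            ∷ []

{-# OPTIONS --safe #-}

-- Adding the relation a ⪯ b to P keeps exactly those order ideals I of P
-- for which b ∈ I implies a ∈ I.  Each entry of the matrix of a source loop is
-- thus a sum over those ideals of P that satisfy a condition on x-L and x-R,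
-- and is compared with the entries of the matrix of P by splitting such
-- a condition into two disjoint ones.

module Submission where

open import Defs
open import Algebra.Bundles using (CommutativeRing)
open import Data.Empty using (⊥-elim)
open import Data.Fin.Base using (Fin)
open import Data.Fin.Subset using (Subset; _∈_; _∉_)
open import Data.Fin.Subset.Properties using (_∈?_)
open import Data.List.Base using (List; []; _∷_; filter)
open import Data.List.Properties using (filter-≐; filter-all; filter-none)
open import Data.List.Relation.Unary.All using (universal)
open import Data.Nat.Base using (ℕ)
open import Data.Product.Base using (_×_; _,_; proj₁; proj₂)
open import Data.Sum.Base using (_⊎_; inj₁; inj₂; [_,_]′)
import Data.Vec.Relation.Binary.Pointwise.Inductive as Vec
open import Function.Base using (_∘_; const)
open import Level using (Level; 0ℓ)
open import Relation.Binary.Construct.Closure.Transitive using ([_])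
open import Relation.Binary.PropositionalEquality.Core as ≡ using (_≡_; refl)
open import Relation.Binary.Structures using (IsPartialOrder)
open import Relation.Nullary.Decidable using (yes; no; _→-dec_)
open import Relation.Nullary.Negation using (¬_)
open import Relation.Unary using (Pred; Decidable; _∩_; _∪_; _≐_; _⊥_; _⊆_)
open import Relation.Unary.Properties using (U?; _∩?_)

private
  variable
    a q s t : Level
    A : Set a
    Q : Pred A q
    S : Pred A s
    T : Pred A t
    n : ℕ

filter-∩ : (Q? : Decidable Q) (S? : Decidable S) (xs : List A) →
           filter S? (filter Q? xs) ≡ filter (Q? ∩? S?) xs
filter-∩ Q? S? [] = refl
filter-∩ Q? S? (x ∷ xs) with Q? x
... | no _ = filter-∩ Q? S? xs
... | yes _ with S? x
...   | yes _ = ≡.cong (x ∷_) (filter-∩ Q? S? xs)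
...   | no _  = filter-∩ Q? S? xs

module _ (P : FinPoset n) (a b : Fin n) where
  open FinPoset P

  Respects : Pred (Subset n) 0ℓ
  Respects I = b ∈ I → a ∈ I

  respects? : Decidable Respects
  respects? I = (b ∈? I) →-dec (a ∈? I)

  module _ (po : IsPartialOrder _≡_ (AddedRelation P a b)) where
    private
      P⁺ = addRelation P a b po

    -- By `fromAdded`, a pair of the enlarged order that is not already in `P` factors as x ⪯ a, b ⪯
    -- y. Down-closure in `P` carries membership from y to b and from a to x, so only the jump from
    -- b to a is a new condition.
    isOrderIdeal-addRelation :
      FinPoset.IsOrderIdeal P⁺ ≐ IsOrderIdeal ∩ Respects
    isOrderIdeal-addRelation = to , from
      where
      to : FinPoset.IsOrderIdeal P⁺ ⊆ IsOrderIdeal ∩ Respects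
      to ideal⁺ = (λ x y x⪯y → ideal⁺ x y [ inj₁ x⪯y ])
                , ideal⁺ a b [ inj₂ (refl , refl) ]

      from : IsOrderIdeal ∩ Respects ⊆ FinPoset.IsOrderIdeal P⁺
      from (ideal , resp) x y x⪯⁺y y∈I with fromAdded P a b x⪯⁺y
      ... | inj₁ x⪯y         = ideal x y x⪯y y∈I
      ... | inj₂ (x⪯a , b⪯y) = ideal x a x⪯a (resp (ideal b y b⪯y y∈I))

    -- Both sides filter the same enumeration `subsets n`, so the lists agree in order as well, and
    -- sums over them can be rewritten without any permutation argument.
    J-addRelation : J P⁺ ≡ filter respects? (J P)
    J-addRelation = ≡.trans
      (filter-≐ _ (isOrderIdeal? ∩? respects?) isOrderIdeal-addRelation (subsets n))
      (≡.sym (filter-∩ isOrderIdeal? respects? (subsets n)))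

module _ {c ℓ} (R : CommutativeRing c ℓ) where
  open CommutativeRing R hiding (refl)
  open Weights R
  open import Algebra.Properties.AbelianGroup +-abelianGroup
    using (x≈z//y; ⁻¹-∙-comm; ε⁻¹≈ε)
  open import Relation.Binary.Reasoning.Setoid setoid

  -- Induction on the list: a head satisfying Q is counted in exactly one of the two sums.
  -- Disjointness and the equivalence exclude every other combination of the three decisions.
  ∑-filter-∪ : (Q? : Decidable Q) (S? : Decidable S) (T? : Decidable T) →
               Q ≐ S ∪ T → S ⊥ T → (xs : List A) (f : A → Carrier) →
               ∑ (filter Q? xs) f ≈ ∑ (filter S? xs) f + ∑ (filter T? xs) f
  ∑-filter-∪ Q? S? T? Q≐S∪T S⊥T [] f = sym (+-identityˡ 0#)
  ∑-filter-∪ Q? S? T? Q≐S∪T@(Q⊆S∪T , S∪T⊆Q) S⊥T (x ∷ xs) f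
    with ih ← ∑-filter-∪ Q? S? T? Q≐S∪T S⊥T xs f | Q? x | S? x | T? x
  ... | _      | yes Sx | yes Tx = ⊥-elim (S⊥T (Sx , Tx))
  ... | yes _  | yes _  | no _   = trans (+-congˡ ih) (sym (+-assoc _ _ _))
  -- The head belongs to the second sum, so it has to be moved past the first one.
  ... | yes _  | no _   | yes _  = begin
    f x + ∑ (filter Q? xs) f                            ≈⟨ +-congˡ (trans ih (+-comm _ _)) ⟩
    f x + (∑ (filter T? xs) f + ∑ (filter S? xs) f)     ≈⟨ +-assoc _ _ _ ⟨
    f x + ∑ (filter T? xs) f + ∑ (filter S? xs) f       ≈⟨ +-comm _ _ ⟩
    ∑ (filter S? xs) f + (f x + ∑ (filter T? xs) f)     ∎
  ... | no _   | no _   | no _   = ih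
  ... | yes Qx | no ¬Sx | no ¬Tx = ⊥-elim ([ ¬Sx , ¬Tx ]′ (Q⊆S∪T Qx))
  ... | no ¬Qx | yes Sx | no _   = ⊥-elim (¬Qx (S∪T⊆Q (inj₁ Sx)))
  ... | no ¬Qx | no _   | yes Tx = ⊥-elim (¬Qx (S∪T⊆Q (inj₂ Tx)))

  module _ (P : FinPoset n) (w : Fin n → Carrier) where

    -- Presents the full polynomial as a restricted sum, the form that `𝒲∣-∪` can split.
    𝒲-U : 𝒲 P w ≈ 𝒲∣ P w U?
    𝒲-U = reflexive (≡.cong (λ Is → ∑ Is (weight w))
      (≡.sym (filter-all U? (universal _ (J P)))))

    module _ {Q : Pred (Subset n) 0ℓ} (Q? : Decidable Q) where

      𝒲∣-∅ : (∀ I → ¬ Q I) → 𝒲∣ P w Q? ≈ 0#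
      𝒲∣-∅ ¬Q = reflexive (≡.cong (λ Is → ∑ Is (weight w))
        (filter-none Q? (universal ¬Q (J P))))

      𝒲∣-cong : {S : Pred (Subset n) 0ℓ} (S? : Decidable S) →
                Q ≐ S → 𝒲∣ P w Q? ≈ 𝒲∣ P w S?
      𝒲∣-cong S? Q≐S = reflexive (≡.cong (λ Is → ∑ Is (weight w))
        (filter-≐ Q? S? Q≐S (J P)))

      𝒲∣-∪ : {S T : Pred (Subset n) 0ℓ} (S? : Decidable S) (T? : Decidable T) →
             Q ≐ S ∪ T → S ⊥ T → 𝒲∣ P w Q? ≈ 𝒲∣ P w S? + 𝒲∣ P w T?
      𝒲∣-∪ S? T? Q≐S∪T S⊥T = ∑-filter-∪ Q? S? T? Q≐S∪T S⊥T (J P) (weight w)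

    module _ (a b : Fin n) (po : IsPartialOrder _≡_ (AddedRelation P a b)) where

      𝒲-addRelation : 𝒲 (addRelation P a b po) w ≈ 𝒲∣ P w (respects? P a b)
      𝒲-addRelation = reflexive (≡.cong (λ Is → ∑ Is (weight w))
        (J-addRelation P a b po))

      𝒲∣-addRelation : {Q : Pred (Subset n) 0ℓ} (Q? : Decidable Q) →
        𝒲∣ (addRelation P a b po) w Q? ≈ 𝒲∣ P w (respects? P a b ∩? Q?)
      𝒲∣-addRelation Q? = reflexive (≡.cong (λ Is → ∑ Is (weight w))
        (≡.trans (≡.cong (filter Q?) (J-addRelation P a b po))
                 (filter-∩ (respects? P a b) Q? (J P))))

  -- No ideal both contains and omits x. This gives the zero corner of both source loops, whose
  -- target and source coincide.
  ℳ↘-source≡target-zero : (P : FinPoset n) (w : Fin n → Carrier) (x : Fin n) →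
    - 𝒲∣ P w (OrientedPoset.R∈,L∉? ⟨ P , x , x ⟩) ≈ 0#
  ℳ↘-source≡target-zero P w x =
    trans (-‿cong (𝒲∣-∅ P w _ λ _ (x∈I , x∉I) → x∉I x∈I)) ε⁻¹≈ε

  module _ (𝐏 : OrientedPoset n) (w : Fin n → Carrier) where
    open OrientedPoset 𝐏 renaming (poset to P)

    ℳ↘-▷↘ : (po : Admissible↘ 𝐏) → ℳ↘ (▷↘ 𝐏 po) w ≈ᴹ loop↘ (ℳ↘ 𝐏 w)
    ℳ↘-▷↘ po = (entry₁₁ Vec.∷ entry₁₂ Vec.∷ Vec.[])
         Vec.∷ (entry₂₁ Vec.∷ ℳ↘-source≡target-zero (↻↘ 𝐏 po) w x-R Vec.∷ Vec.[])
         Vec.∷ Vec.[]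
      where
      C? = respects? P x-L x-R

      -- The ideals lost by adding the relation are those counted, with a minus sign, by the entry d
      -- of `ℳ↘ 𝐏 w`.
      respects⊎violates : ∀ I → Respects P x-L x-R I ⊎ (x-R ∈ I × x-L ∉ I)
      respects⊎violates I with x-R ∈? I | x-L ∈? I
      ... | _      | yes L∈ = inj₁ (const L∈)
      ... | no R∉  | no _   = inj₁ (⊥-elim ∘ R∉)
      ... | yes R∈ | no L∉  = inj₂ (R∈ , L∉)

      entry₁₁ : 𝒲 (↻↘ 𝐏 po) w ≈ 𝒲 P w - 𝒲∣ P w R∈,L∉?
      -- All ideals of `P` split into surviving and lost ones; `x≈z//y` then moves the lost part to
      -- the other side as a subtraction.
      entry₁₁ = trans (𝒲-addRelation P w x-L x-R po) (x≈z//y _ _ _ (sym (trans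
        (𝒲-U P w)
        (𝒲∣-∪ P w U? C? R∈,L∉? ((λ _ → respects⊎violates _) , _)
          λ (R→L , R∈ , L∉) → L∉ (R→L R∈)))))

      entry₁₂ : - 𝒲∣ (↻↘ 𝐏 po) w R∈? ≈ - 𝒲∣ P w R∈? - - 𝒲∣ P w R∈,L∉?
      entry₁₂ = begin
        - 𝒲∣ (↻↘ 𝐏 po) w R∈?                ≈⟨ -‿cong (𝒲∣-addRelation P w x-L x-R po R∈?) ⟩
        - 𝒲∣ P w (C? ∩? R∈?)                ≈⟨ -‿cong (x≈z//y _ _ _ (sym split)) ⟩
        - (𝒲∣ P w R∈? - 𝒲∣ P w R∈,L∉?)      ≈⟨ ⁻¹-∙-comm _ _ ⟨
        - 𝒲∣ P w R∈? - - 𝒲∣ P w R∈,L∉?      ∎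
        where
        split : 𝒲∣ P w R∈? ≈ 𝒲∣ P w (C? ∩? R∈?) + 𝒲∣ P w R∈,L∉?
        -- Every lost ideal contains `x-R`, so the whole lost part is removed here too.
        split = 𝒲∣-∪ P w R∈? (C? ∩? R∈?) R∈,L∉?
          ( (λ R∈ → [ (λ R→L → inj₁ (R→L , R∈)) , inj₂ ]′ (respects⊎violates _))
          , [ proj₂ , proj₁ ]′)
          λ ((R→L , R∈) , _ , L∉) → L∉ (R→L R∈)

      -- The target of the loop is `x-R`, hence the condition `R∉?`. Under it the added relation
      -- constrains nothing, and what remains is the complement of the ideals containing `x-R`.
      entry₂₁ : 𝒲∣ (↻↘ 𝐏 po) w R∉? ≈ 𝒲 P w - 𝒲∣ P w R∈?
      entry₂₁ = begin
        𝒲∣ (↻↘ 𝐏 po) w R∉?     ≈⟨ 𝒲∣-addRelation P w x-L x-R po R∉? ⟩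
        𝒲∣ P w (C? ∩? R∉?)     ≈⟨ x≈z//y _ _ _ (sym (trans (𝒲-U P w) split)) ⟩
        𝒲 P w - 𝒲∣ P w R∈?     ∎
        where
        R∉⊎R∈ : ∀ I → (Respects P x-L x-R I × x-R ∉ I) ⊎ x-R ∈ I
        R∉⊎R∈ I with x-R ∈? I
        ... | yes R∈ = inj₂ R∈
        ... | no R∉  = inj₁ (⊥-elim ∘ R∉ , R∉)

        split : 𝒲∣ P w U? ≈ 𝒲∣ P w (C? ∩? R∉?) + 𝒲∣ P w R∈?
        split = 𝒲∣-∪ P w U? (C? ∩? R∉?) R∈? ((λ _ → R∉⊎R∈ _) , _)
          λ ((_ , R∉) , R∈) → R∉ R∈

    ℳ↘-▷↗ : (po : Admissible↗ 𝐏) → ℳ↘ (▷↗ 𝐏 po) w ≈ᴹ loop↗ (ℳ↗ 𝐏 w)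
    ℳ↘-▷↗ po = (entry₁₁ Vec.∷ entry₁₂ Vec.∷ Vec.[])
         Vec.∷ (entry₂₁ Vec.∷ ℳ↘-source≡target-zero (↻↗ 𝐏 po) w x-R Vec.∷ Vec.[])
         Vec.∷ Vec.[]
      where
      C? = respects? P x-R x-L

      respects⇒ : Respects P x-R x-L ⊆ (x-R ∈_) ∪ (λ I → x-R ∉ I × x-L ∉ I)
      respects⇒ {I} L→R with x-R ∈? I
      ... | yes R∈ = inj₁ R∈
      ... | no R∉  = inj₂ (R∉ , R∉ ∘ L→R)

      entry₁₁ : 𝒲 (↻↗ 𝐏 po) w ≈ 𝒲∣ P w R∈? + 𝒲∣ P w R∉,L∉?
      entry₁₁ = trans (𝒲-addRelation P w x-R x-L po)
        (𝒲∣-∪ P w C? R∈? R∉,L∉?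
          (respects⇒ , [ const , (λ (_ , L∉) → ⊥-elim ∘ L∉) ]′)
          λ (R∈ , R∉ , _) → R∉ R∈)

      entry₁₂ : - 𝒲∣ (↻↗ 𝐏 po) w R∈? ≈ - 𝒲∣ P w R∈?
      -- Once `x-R` is in the ideal, the conclusion of the implication holds, so no such ideal is
      -- lost.
      entry₁₂ = -‿cong (trans (𝒲∣-addRelation P w x-R x-L po R∈?)
        (𝒲∣-cong P w (C? ∩? R∈?) R∈? (proj₂ , λ R∈ → const R∈ , R∈)))

      entry₂₁ : 𝒲∣ (↻↗ 𝐏 po) w R∉? ≈ 𝒲∣ P w R∉,L∉?
      entry₂₁ = trans (𝒲∣-addRelation P w x-R x-L po R∉?)
        (𝒲∣-cong P w (C? ∩? R∉?) R∉,L∉?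
          ( (λ (L→R , R∉) → R∉ , R∉ ∘ L→R)
          , (λ (R∉ , L∉) → ⊥-elim ∘ L∉ , R∉)))

theorem5p5 : ∀ {c ℓ} (R : CommutativeRing c ℓ) →
    let open Weights R in
    {n : ℕ} (𝐏 : OrientedPoset n) (w : Fin n → CommutativeRing.Carrier R) →
    ((po : Admissible↘ 𝐏) → ℳ↘ (▷↘ 𝐏 po) w ≈ᴹ loop↘ (ℳ↘ 𝐏 w)) ×
    ((po : Admissible↗ 𝐏) → ℳ↘ (▷↗ 𝐏 po) w ≈ᴹ loop↗ (ℳ↗ 𝐏 w))
theorem5p5 R 𝐏 w = ℳ↘-▷↘ R 𝐏 w , ℳ↘-▷↗ R 𝐏 w
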